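{- There is a function $\varepsilon:\mathbb{Z}^+\to\mathbb{R}$ with $\varepsilon(n)\to 0$ as $n\to\infty$ such that for every $n\in\mathbb{Z}^+$ there exists a positive integer $k \leq 2^{2^{2n \lg(n) (1 + \varepsilon(n))}}$ with $\#I(k) \geq n$. (In the paper's notation: $k \leq 2^{2^{2n \lg(n) (1 + o(1))}}$.)
   Context: For a prime $p$ and $c\in\mathbb{Z}^+$, let $I_{p,c}=\{p^c, p^c+1,\dots,p^c+p^{c-1}-1\}$. For a positive integer $k$, $\#I(k)$ denotes the number of pairs $(p,c)$ with $p$ prime, $c\in\mathbb{Z}^+$, and $k\in I_{p,c}$. $\lg$ denotes $\log_2$. -}

module Defs where

open import Data.Nat using (ℕ; zero; suc; _+_; _*_; _^_; _≤_; _<_)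
open import Data.Nat.Primality using (Prime)
open import Data.Product using (_×_; Σ; ∃; _,_)
open import Data.List using (List; length)
open import Data.List.Relation.Unary.All using (All)
open import Data.List.Relation.Unary.Unique.Propositional using (Unique)

_∈I[_,_] : ℕ → ℕ → ℕ → Set
k ∈I[ p , c ] = 1 ≤ c × (p ^ c ≤ k) × (k < p ^ c + p ^ (c Data.Nat.∸ 1))

GoodPair : ℕ → ℕ × ℕ → Set
GoodPair k (p , c) = Prime p × k ∈I[ p , c ]

AtLeastI : ℕ → ℕ → Set
AtLeastI n k = Σ (List (ℕ × ℕ)) λ ps →
  Unique ps × All (GoodPair k) ps × n ≤ length ps

{-# OPTIONS --safe #-}

-- Take n primes p ≤ P and Q = 2P + 1. For 0 ≤ t ≤ (QP)^n the tuple of numbers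
-- ⌊Q 2^t / p^⌊log_p 2^t⌋⌋ takes at most (QP)^n values, so two exponents t collide,
-- and their difference d makes 2^d agree with a power p^e of each of the primes up
-- to a factor 1 + 1/Q. Since (1 + 1/Q)² ≤ 1 + 1/p, the largest of these powers lies
-- in all the intervals I_{p,e}.
-- Chebyshev's bound allows P = n^(1 + o(1)), hence log₂ k ≤ (2P)^(2n) = n^(2n(1 + o(1))).
-- It comes from Nair's argument: the Leibniz harmonic triangle shows that k C(2k, k)
-- divides every common multiple of 1, …, 2k, one of which is the product of the
-- maximal prime powers not exceeding 2k, itself at most (2k)^π(2k).

module Submission where

open import Defs
open import Data.Nat using (ℕ; zero; suc; _+_; _*_; _^_; _∸_; _/_; _%_; _≤_; _<_; _≤?_; z≤n; s≤s; NonZero; NonTrivial; >-nonZero; nonTrivial⇒n>1)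
open import Data.Nat.Combinatorics using (_C_; nC1≡n; nCk+nC[k+1]≡[n+1]C[k+1])
open import Data.Nat.Divisibility using (_∣_; _∣?_; divides; ∣-trans; ∣-refl; *-pres-∣; m∣m*n; ∣⇒≤)
open import Data.Nat.DivMod using (m/n*n≤m; m≡m%n+[m/n]*n; m%n<n; m<n*o⇒m/o<n; m*n/n≡m; /-monoˡ-≤)
open import Data.Nat.ListAction using (product)
open import Data.Nat.Primality using (Prime; prime?; prime[2]; prime⇒nonTrivial; prime⇒nonZero)
open import Data.Nat.Primality.Factorisation using (factorise)
open import Data.Nat.Properties
open import Data.Nat.Tactic.RingSolver using (solve-∀)
open import Data.Fin using (Fin; zero; suc; toℕ; fromℕ<; finToFun; funToFin; inject≤)
open import Data.Fin.Properties using (pigeonhole; finToFun-funToFin; toℕ-fromℕ<; toℕ<n; inject≤-injective)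
open import Data.List using (List; []; _∷_; length; map; filter; upTo; lookup; tabulate)
open import Data.List.Properties using (length-tabulate)
open import Data.List.Membership.Propositional using (_∈_)
open import Data.List.Membership.Propositional.Properties using (∈-filter⁺; ∈-filter⁻; ∈-upTo⁺; ∈-upTo⁻; ∈-lookup)
open import Data.List.Relation.Unary.All using (All; []; _∷_)
import Data.List.Relation.Unary.All as All
open import Data.List.Relation.Unary.Any using (tail)
open import Data.List.Relation.Unary.Unique.Propositional using (Unique; []; _∷_)
import Data.List.Relation.Unary.All.Properties as All
import Data.List.Relation.Unary.Unique.Propositional.Properties as Unique
open import Data.Product using (_×_; _,_; Σ; ∃-syntax; proj₁; proj₂)
open import Data.Sum using (inj₁; inj₂)
open import Relation.Nullary using (¬_; yes; no; contradiction)
open import Relation.Binary.PropositionalEquality using (_≡_; refl; sym; trans; cong; cong₂; subst; subst₂)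

open ≤-Reasoning

-- Binomial coefficients

[1+k]*[1+n]C[1+k]≡[1+n]*nCk : ∀ n k → suc k * (suc n C suc k) ≡ suc n * (n C k)
[1+k]*[1+n]C[1+k]≡[1+n]*nCk n zero = trans (*-identityˡ _) (trans (nC1≡n (suc n)) (sym (*-identityʳ _)))
[1+k]*[1+n]C[1+k]≡[1+n]*nCk zero (suc k) = *-zeroʳ (2 + k)
[1+k]*[1+n]C[1+k]≡[1+n]*nCk (suc n) (suc k) = begin-equality
  (2 + k) * (suc (suc n) C suc (suc k))
    ≡⟨ cong ((2 + k) *_) (nCk+nC[k+1]≡[n+1]C[k+1] (suc n) (suc k)) ⟨
  (2 + k) * ((suc n C suc k) + (suc n C suc (suc k)))
    ≡⟨ split k (suc n C suc k) (suc n C suc (suc k)) ⟩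
  suc k * (suc n C suc k) + (suc n C suc k) + (2 + k) * (suc n C suc (suc k))
    ≡⟨ cong₂ (λ u v → u + (suc n C suc k) + v) ([1+k]*[1+n]C[1+k]≡[1+n]*nCk n k) ([1+k]*[1+n]C[1+k]≡[1+n]*nCk n (suc k)) ⟩
  suc n * (n C k) + (suc n C suc k) + suc n * (n C suc k)
    ≡⟨ collect n (n C k) (suc n C suc k) (n C suc k) ⟩
  suc n * ((n C k) + (n C suc k)) + (suc n C suc k)
    ≡⟨ cong (λ u → suc n * u + (suc n C suc k)) (nCk+nC[k+1]≡[n+1]C[k+1] n k) ⟩
  suc n * (suc n C suc k) + (suc n C suc k)
    ≡⟨ +-comm (suc n * (suc n C suc k)) _ ⟩
  (2 + n) * (suc n C suc k) ∎
  where
  split : ∀ k x y → (2 + k) * (x + y) ≡ suc k * x + x + (2 + k) * y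
  split = solve-∀
  collect : ∀ n x y z → suc n * x + y + suc n * z ≡ suc n * (x + z) + y
  collect = solve-∀

-- By the absorption identity, passing from C(n, k) to C(n+1, k+1) multiplies by (n+1)/(k+1), which
-- is at least 2 here.
2^k≤nCk : ∀ k n → 2 * k ≤ n → 2 ^ k ≤ n C k
2^k≤nCk zero n _ = ≤-refl
2^k≤nCk (suc k) (suc n) 2+2k≤1+n = *-cancelˡ-≤ (suc k) (begin
  suc k * (2 * 2 ^ k)     ≡⟨ *-assoc (suc k) 2 (2 ^ k) ⟨
  suc k * 2 * 2 ^ k       ≤⟨ *-mono-≤ (≤-trans (≤-reflexive (*-comm (suc k) 2)) 2+2k≤1+n) (2^k≤nCk k n 2k≤n) ⟩
  suc n * (n C k)         ≡⟨ [1+k]*[1+n]C[1+k]≡[1+n]*nCk n k ⟨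
  suc k * (suc n C suc k) ∎)
  where
  2k≤n : 2 * k ≤ n
  2k≤n = ≤-trans (n≤1+n (2 * k)) (≤-pred (subst (_≤ suc n) (*-suc 2 k) 2+2k≤1+n))

-- The hypothesis on x, y, z says 1/z = 1/x - 1/y.
reciprocal-difference-∣ : ∀ {x y z D} .{{_ : NonZero x}} .{{_ : NonZero y}} →
  y * z ≡ x * z + x * y → x ∣ D → y ∣ D → z ∣ D
reciprocal-difference-∣ {x} {y} {z} {D} eq (divides u D≡ux) (divides v D≡vy) =
  -- `u` = D/x and `v` = D/y, so `u ∸ v` is D/z; the identity is checked after multiplying by xy.
  divides (u ∸ v) (sym (*-cancelʳ-≡ ((u ∸ v) * z) D (x * y) {{m*n≢0 x y}} (begin-equality
    (u ∸ v) * z * (x * y)                 ≡⟨ *-assoc (u ∸ v) z (x * y) ⟩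
    (u ∸ v) * (z * (x * y))               ≡⟨ *-distribʳ-∸ (z * (x * y)) u v ⟩
    u * (z * (x * y)) ∸ v * (z * (x * y)) ≡⟨ cong₂ _∸_ (regroup₁ u z x y) (regroup₂ v z x y) ⟩
    u * x * (y * z) ∸ v * y * (x * z)     ≡⟨ cong₂ (λ s t → s * (y * z) ∸ t * (x * z)) D≡ux D≡vy ⟨
    D * (y * z) ∸ D * (x * z)             ≡⟨ *-distribˡ-∸ D (y * z) (x * z) ⟨
    D * (y * z ∸ x * z)                   ≡⟨ cong (λ s → D * (s ∸ x * z)) eq ⟩
    D * (x * z + x * y ∸ x * z)           ≡⟨ cong (D *_) (m+n∸m≡n (x * z) (x * y)) ⟩
    D * (x * y)                           ∎)))
  where
  regroup₁ : ∀ u z x y → u * (z * (x * y)) ≡ u * x * (y * z)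
  regroup₁ = solve-∀
  regroup₂ : ∀ v z x y → v * (z * (x * y)) ≡ v * y * (x * z)
  regroup₂ = solve-∀

-- Common multiples of 1, ..., N and the Leibniz triangle

CommonMultiple : ℕ → ℕ → Set
CommonMultiple N D = ∀ m → 1 ≤ m → m ≤ N → m ∣ D

nCk≢0 : ∀ {k n} → k ≤ n → NonZero (n C k)
nCk≢0 {zero} _ = _
nCk≢0 {suc k} {suc n} (s≤s k≤n) = m*n≢0⇒n≢0 (suc k) {{subst NonZero (sym ([1+k]*[1+n]C[1+k]≡[1+n]*nCk n k)) (m*n≢0 (suc n) (n C k) {{_}} {{nCk≢0 k≤n}})}}

-- The numbers (n + 1) C(n, k) are the denominators of the Leibniz harmonic
-- triangle, in which each entry is a difference of two previous ones.
[1+n]*nCk∣commonMultiple : ∀ {N D} → CommonMultiple N D → ∀ k n → k ≤ n → suc n ≤ N → suc n * (n C k) ∣ D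
[1+n]*nCk∣commonMultiple {D = D} cm zero n _ n<N = subst (_∣ D) (sym (*-identityʳ (suc n))) (cm (suc n) (s≤s z≤n) n<N)
[1+n]*nCk∣commonMultiple cm (suc k) (suc n) (s≤s k≤n) n<N =
  -- Induction on the column: entry k + 1 of row n + 1 comes from the entries in column k of rows n
  -- and n + 1. Column 0 consists of the integers themselves.
  reciprocal-difference-∣
    {{m*n≢0 (suc n) (n C k) {{_}} {{nCk≢0 k≤n}}}}
    {{m*n≢0 (2 + n) (suc n C k) {{_}} {{nCk≢0 (m≤n⇒m≤1+n k≤n)}}}}
    (begin-equality
      (2 + n) * (suc n C k) * ((2 + n) * (suc n C suc k))
        ≡⟨ cong (_* ((2 + n) * (suc n C suc k))) ([1+k]*[1+n]C[1+k]≡[1+n]*nCk (suc n) k) ⟨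
      suc k * (suc (suc n) C suc k) * ((2 + n) * (suc n C suc k))
        ≡⟨ swap (suc k) (suc (suc n) C suc k) (2 + n) (suc n C suc k) ⟩
      suc k * (suc n C suc k) * ((2 + n) * (suc (suc n) C suc k))
        ≡⟨ cong₂ (λ u v → u * ((2 + n) * v)) ([1+k]*[1+n]C[1+k]≡[1+n]*nCk n k) (sym (nCk+nC[k+1]≡[n+1]C[k+1] (suc n) k)) ⟩
      suc n * (n C k) * ((2 + n) * ((suc n C k) + (suc n C suc k)))
        ≡⟨ expand (suc n * (n C k)) (2 + n) (suc n C k) (suc n C suc k) ⟩
      suc n * (n C k) * ((2 + n) * (suc n C suc k)) + suc n * (n C k) * ((2 + n) * (suc n C k)) ∎)
    ([1+n]*nCk∣commonMultiple cm k n k≤n (≤-trans (n≤1+n _) n<N))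
    ([1+n]*nCk∣commonMultiple cm k (suc n) (m≤n⇒m≤1+n k≤n) n<N)
  where
  swap : ∀ a b c d → a * b * (c * d) ≡ a * d * (c * b)
  swap = solve-∀
  expand : ∀ a b c d → a * (b * (c + d)) ≡ a * (b * d) + a * (b * c)
  expand = solve-∀

-- With K = k + 1, the triangle entry used here is K C(2K, K); the crude bound 2^k for the binomial
-- already suffices.
2^k≤commonMultiple : ∀ k {D} .{{_ : NonZero D}} → CommonMultiple (2 * suc k) D → 2 ^ suc k ≤ D
2^k≤commonMultiple k {D} cm = begin
  2 * 2 ^ k                       ≤⟨ *-mono-≤ 2≤1+n (2^k≤nCk k n (n≤1+n (2 * k))) ⟩
  suc n * (n C k)                 ≤⟨ ∣⇒≤ ([1+n]*nCk∣commonMultiple cm k n k≤n (≤-reflexive (sym (*-suc 2 k)))) ⟩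
  D                               ∎
  where
  n = suc (2 * k)
  2≤1+n : 2 ≤ suc n
  2≤1+n = s≤s (s≤s z≤n)
  k≤n : k ≤ n
  k≤n = m≤n⇒m≤1+n (m≤m+n k (k + 0))

-- Integer logarithms

-- For b > 1, x < b^(L+1) gives x + 1 ≤ b^(L+1), so the logarithm rises by at most one per step and
-- a single comparison is enough. The value at 0 is a convention.
⌊log⌋ : ℕ → ℕ → ℕ
⌊log⌋ b zero = 0
⌊log⌋ b (suc x) with b ^ suc (⌊log⌋ b x) ≤? suc x
... | yes _ = suc (⌊log⌋ b x)
... | no  _ = ⌊log⌋ b x

b^⌊log⌋≤ : ∀ b x → 1 ≤ x → b ^ ⌊log⌋ b x ≤ x
b^⌊log⌋≤ b (suc x) _ with b ^ suc (⌊log⌋ b x) ≤? suc x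
... | yes p = p
b^⌊log⌋≤ b (suc zero) _ | no _ = ≤-refl
b^⌊log⌋≤ b (suc x@(suc _)) _ | no _ = m≤n⇒m≤1+n (b^⌊log⌋≤ b x (s≤s z≤n))

<b^[1+⌊log⌋] : ∀ b x → 1 < b → x < b ^ suc (⌊log⌋ b x)
<b^[1+⌊log⌋] b zero 1<b = subst (0 <_) (sym (*-identityʳ b)) (<-trans (s≤s z≤n) 1<b)
<b^[1+⌊log⌋] b (suc x) 1<b with b ^ suc (⌊log⌋ b x) ≤? suc x
... | yes _ = ≤-<-trans (<b^[1+⌊log⌋] b x 1<b) (^-monoʳ-< b 1<b (n<1+n (suc (⌊log⌋ b x))))
... | no ¬p = ≰⇒> ¬p

^-cancelʳ-< : ∀ b .{{_ : NonZero b}} {m n} → b ^ m < b ^ n → m < n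
^-cancelʳ-< b b^m<b^n = ≰⇒> λ n≤m → <⇒≱ b^m<b^n (^-monoʳ-≤ b n≤m)

-- A lower bound for the number of primes

extractPower : ∀ p .{{_ : NonTrivial p}} m → 1 ≤ m → ∃[ a ] ∃[ m′ ] m ≡ p ^ a * m′ × 1 ≤ m′ × ¬ (p ∣ m′)
extractPower p m = go m m ≤-refl
  where
  go : ∀ fuel m → m ≤ fuel → 1 ≤ m → ∃[ a ] ∃[ m′ ] m ≡ p ^ a * m′ × 1 ≤ m′ × ¬ (p ∣ m′)
  go fuel m m≤fuel 1≤m with p ∣? m
  ... | no p∤m = 0 , m , sym (*-identityˡ m) , 1≤m , p∤m
  go (suc fuel) m@(suc _) m≤fuel 1≤m | yes (divides q@(suc _) m≡qp)
    with a , m′ , q≡ , 1≤m′ , p∤m′ ← go fuel q (≤-pred (≤-trans (subst (q <_) (sym m≡qp) (m<m*n q p (nonTrivial⇒n>1 p))) m≤fuel)) (s≤s z≤n)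
    = suc a , m′ , trans m≡qp (trans (cong (_* p) q≡) (rotate (p ^ a) m′ p)) , 1≤m′ , p∤m′
    where
    rotate : ∀ x y z → x * y * z ≡ z * x * y
    rotate = solve-∀

noPrimeDivisor⇒≡1 : ∀ m → 1 ≤ m → (∀ q → Prime q → ¬ (q ∣ m)) → m ≡ 1
noPrimeDivisor⇒≡1 m@(suc _) _ none with factorise m
... | record { factors = [] ; isFactorisation = eq } = eq
... | record { factors = q ∷ qs ; isFactorisation = eq ; factorsPrime = q-prime ∷ _ } =
  contradiction (subst (q ∣_) (sym eq) (m∣m*n (product qs))) (none q q-prime)

-- When `ps` lists the primes up to N, this is lcm(1, ..., N).
maxPowers : ℕ → List ℕ → ℕ
maxPowers N ps = product (map (λ p → p ^ ⌊log⌋ p N) ps)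

maxPowers≤ : ∀ N → 1 ≤ N → ∀ ps → maxPowers N ps ≤ N ^ length ps
maxPowers≤ N 1≤N [] = ≤-refl
maxPowers≤ N 1≤N (p ∷ ps) = *-mono-≤ (b^⌊log⌋≤ p N 1≤N) (maxPowers≤ N 1≤N ps)

maxPowers>0 : ∀ N ps → All Prime ps → 1 ≤ maxPowers N ps
maxPowers>0 N [] [] = ≤-refl
maxPowers>0 N (p ∷ ps) (pp ∷ pps) = *-mono-≤ (m^n>0 p {{prime⇒nonZero pp}} (⌊log⌋ p N)) (maxPowers>0 N ps pps)

-- Split m = p^a m′ with p not dividing m′. Then p^a ≤ m ≤ N bounds a by the logarithm, and the
-- prime divisors of m′ lie in the tail. Tracking only the prime divisors of m lets the induction on
-- `ps` go through.
∣maxPowers : ∀ {N} ps → All Prime ps → ∀ m → 1 ≤ m → m ≤ N →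
  (∀ q → Prime q → q ∣ m → q ∈ ps) → m ∣ maxPowers N ps
∣maxPowers [] [] m 1≤m _ divisors∈ =
  subst (_∣ 1) (sym (noPrimeDivisor⇒≡1 m 1≤m (λ q q-prime q∣m → contradiction (divisors∈ q q-prime q∣m) λ ()))) ∣-refl
∣maxPowers {N} (p ∷ ps) (p-prime ∷ ps-prime) m 1≤m m≤N divisors∈
  with a , m′ , m≡ , 1≤m′ , p∤m′ ← extractPower p {{prime⇒nonTrivial p-prime}} m 1≤m
  = subst (_∣ _) (sym m≡) (*-pres-∣ p^a∣ m′∣)
  where
  instance
    p≢0 : NonZero p
    p≢0 = prime⇒nonZero p-prime
    m≢0 : NonZero m
    m≢0 = >-nonZero 1≤m
  1<p : 1 < p
  1<p = nonTrivial⇒n>1 p {{prime⇒nonTrivial p-prime}}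
  m′∣m : m′ ∣ m
  m′∣m = divides (p ^ a) m≡
  a<1+log : a < suc (⌊log⌋ p N)
  a<1+log = ^-cancelʳ-< p (≤-<-trans (≤-trans (∣⇒≤ (divides m′ (trans m≡ (*-comm (p ^ a) m′)))) m≤N) (<b^[1+⌊log⌋] p N 1<p))
  p^a∣ : p ^ a ∣ p ^ ⌊log⌋ p N
  p^a∣ = divides (p ^ (⌊log⌋ p N ∸ a)) (trans (cong (p ^_) (sym (m∸n+n≡m (≤-pred a<1+log)))) (^-distribˡ-+-* p (⌊log⌋ p N ∸ a) a))
  m′∣ : m′ ∣ maxPowers N ps
  m′∣ = ∣maxPowers ps ps-prime m′ 1≤m′ (≤-trans (∣⇒≤ m′∣m) m≤N) λ q q-prime q∣m′ →
    tail (λ { refl → p∤m′ q∣m′ }) (divisors∈ q q-prime (∣-trans q∣m′ m′∣m))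

primesUpTo : ℕ → List ℕ
primesUpTo N = filter prime? (upTo (suc N))

primesUpTo-prime : ∀ N → All Prime (primesUpTo N)
primesUpTo-prime N = All.all-filter prime? (upTo (suc N))

primesUpTo-≤ : ∀ {N p} → p ∈ primesUpTo N → p ≤ N
primesUpTo-≤ {N} p∈ = ≤-pred (∈-upTo⁻ (proj₁ (∈-filter⁻ prime? {xs = upTo (suc N)} p∈)))

maxPowers-commonMultiple : ∀ N → CommonMultiple N (maxPowers N (primesUpTo N))
maxPowers-commonMultiple N m 1≤m m≤N = ∣maxPowers _ (primesUpTo-prime N) m 1≤m m≤N
  λ q q-prime q∣m → ∈-filter⁺ prime? (∈-upTo⁺ (s≤s (≤-trans (∣⇒≤ {{>-nonZero 1≤m}} q∣m) m≤N))) q-prime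

-- Combines 2^k ≤ lcm(1, ..., 2k) ≤ (2k)^π(2k) with the hypothesis and compares exponents of 2k.
manyPrimes : ∀ n k → 1 ≤ k → (2 * k) ^ n ≤ 2 ^ k → n ≤ length (primesUpTo (2 * k))
manyPrimes n (suc k) _ N^n≤2^k = ≮⇒≥ λ len<n → <-irrefl refl (begin-strict
  N ^ length ps  <⟨ ^-monoʳ-< N 1<N len<n ⟩
  N ^ n          ≤⟨ N^n≤2^k ⟩
  2 ^ suc k      ≤⟨ 2^k≤commonMultiple k {{>-nonZero (maxPowers>0 N ps (primesUpTo-prime N))}} (maxPowers-commonMultiple N) ⟩
  maxPowers N ps ≤⟨ maxPowers≤ N (<⇒≤ 1<N) ps ⟩
  N ^ length ps  ∎)
  where
  N = 2 * suc k
  ps = primesUpTo N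
  1<N : 1 < N
  1<N = subst (1 <_) (sym (*-suc 2 k)) (s≤s (s≤s z≤n))

-- Simultaneous approximation

-- The ratios x/y and y/x are both below 1 + 1/Q, with denominators cleared.
Close : ℕ → ℕ → ℕ → Set
Close Q x y = x * Q < suc Q * y × y * Q < suc Q * x

ratio-weaken : ∀ Q q x y .{{_ : NonZero Q}} → Q ≤ q → x * q < suc q * y → x * Q < suc Q * y
ratio-weaken Q q x y Q≤q xq<[1+q]y = *-cancelʳ-< q (x * Q) (suc Q * y) (begin-strict
  x * Q * q         ≡⟨ swap x Q q ⟩
  x * q * Q         <⟨ *-monoˡ-< Q xq<[1+q]y ⟩
  suc q * y * Q     ≡⟨ expand q y Q ⟩
  y * Q + q * y * Q ≤⟨ +-monoˡ-≤ (q * y * Q) (*-monoʳ-≤ y Q≤q) ⟩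
  y * q + q * y * Q ≡⟨ collect q y Q ⟩
  suc Q * y * q     ∎)
  where
  swap : ∀ x y z → x * y * z ≡ x * z * y
  swap = solve-∀
  expand : ∀ q y Q → suc q * y * Q ≡ y * Q + q * y * Q
  expand = solve-∀
  collect : ∀ q y Q → y * q + q * y * Q ≡ suc Q * y * q
  collect = solve-∀

-- For b > 0 this says q = ⌊Qa/b⌋, that is, a/b lies in [q/Q, (q+1)/Q).
InCell : ℕ → ℕ → ℕ → ℕ → Set
InCell Q q a b = q * b ≤ Q * a × Q * a < suc q * b

/-inCell : ∀ Q a b .{{_ : NonZero b}} → InCell Q (Q * a / b) a b
/-inCell Q a b = m/n*n≤m (Q * a) b , (begin-strict
  Q * a                               ≡⟨ m≡m%n+[m/n]*n (Q * a) b ⟩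
  Q * a % b + Q * a / b * b           <⟨ +-monoˡ-< (Q * a / b * b) (m%n<n (Q * a) b) ⟩
  b + Q * a / b * b                   ∎)

-- Two ratios in the cell [q/Q, (q+1)/Q) have a quotient strictly between q/(q+1) and (q+1)/q. That
-- quotient is x/y up to inversion, and q ≥ Q weakens 1/q to 1/Q.
sameCell⇒Close : ∀ Q q a b x y .{{_ : NonZero Q}} .{{_ : NonZero x}} .{{_ : NonZero y}} → Q ≤ q →
  InCell Q q a b → InCell Q q (a * x) (b * y) → Close Q x y
sameCell⇒Close Q q a b x y Q≤q (qb≤Qa , Qa<[1+q]b) (qby≤Qax , Qax<[1+q]by) =
  ratio-weaken Q q x y Q≤q (*-cancelˡ-< b (x * q) (suc q * y) (begin-strict
    b * (x * q)       ≡⟨ r₁ b x q ⟩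
    q * b * x         ≤⟨ *-monoˡ-≤ x qb≤Qa ⟩
    Q * a * x         ≡⟨ *-assoc Q a x ⟩
    Q * (a * x)       <⟨ Qax<[1+q]by ⟩
    suc q * (b * y)   ≡⟨ r₂ (suc q) b y ⟩
    b * (suc q * y)   ∎)) ,
  ratio-weaken Q q y x Q≤q (*-cancelˡ-< b (y * q) (suc q * x) (begin-strict
    b * (y * q)       ≡⟨ r₃ b y q ⟩
    q * (b * y)       ≤⟨ qby≤Qax ⟩
    Q * (a * x)       ≡⟨ *-assoc Q a x ⟨
    Q * a * x         <⟨ *-monoˡ-< x Qa<[1+q]b ⟩
    suc q * b * x     ≡⟨ r₄ (suc q) b x ⟩
    b * (suc q * x)   ∎))
  where
  r₁ : ∀ b x q → b * (x * q) ≡ q * b * x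
  r₁ = solve-∀
  r₂ : ∀ q b y → q * (b * y) ≡ b * (q * y)
  r₂ = solve-∀
  r₃ : ∀ b y q → b * (y * q) ≡ q * (b * y)
  r₃ = solve-∀
  r₄ : ∀ q b x → q * b * x ≡ b * (q * x)
  r₄ = solve-∀

^-split : ∀ b {m n} → m ≤ n → b ^ n ≡ b ^ m * b ^ (n ∸ m)
^-split b {m} {n} m≤n = trans (cong (b ^_) (sym (m+[n∸m]≡n m≤n))) (^-distribˡ-+-* b m (n ∸ m))

module _ (P n Q : ℕ) .{{Q≢0 : NonZero Q}} (p : Fin n → ℕ) (1<p : ∀ i → 1 < p i) (p≤P : ∀ i → p i ≤ P) where

  private
    instance
      p≢0 : ∀ {i} → NonZero (p i)
      p≢0 {i} = >-nonZero (<-trans (s≤s z≤n) (1<p i))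

    expo : ℕ → Fin n → ℕ
    expo t i = ⌊log⌋ (p i) (2 ^ t)

    p^expo≢0 : ∀ {t i} → NonZero (p i ^ expo t i)
    p^expo≢0 {t} {i} = m^n≢0 (p i) (expo t i)

    p^expo≤2^ : ∀ t i → p i ^ expo t i ≤ 2 ^ t
    p^expo≤2^ t i = b^⌊log⌋≤ (p i) (2 ^ t) (m^n>0 2 t)

    2^<p^[1+expo] : ∀ t i → 2 ^ t < p i ^ suc (expo t i)
    2^<p^[1+expo] t i = <b^[1+⌊log⌋] (p i) (2 ^ t) (1<p i)

    expo-mono : ∀ {s t} i → s ≤ t → expo s i ≤ expo t i
    expo-mono {s} {t} i s≤t = ≤-pred (^-cancelʳ-< (p i)
      (≤-<-trans (≤-trans (p^expo≤2^ s i) (^-monoʳ-≤ 2 s≤t)) (2^<p^[1+expo] t i)))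

    -- The ratio 2^t / p^expo lies in [1, p), so the cell number lies in [Q, QP): the lower end
    -- yields the precision 1/Q, the upper end the count of cells.
    cell : ℕ → Fin n → ℕ
    cell t i = (Q * 2 ^ t / p i ^ expo t i) {{p^expo≢0 {t} {i}}}

    Q≤cell : ∀ t i → Q ≤ cell t i
    Q≤cell t i = begin
      Q                                ≡⟨ m*n/n≡m Q (p i ^ expo t i) {{p^expo≢0 {t} {i}}} ⟨
      (Q * p i ^ expo t i / p i ^ expo t i) {{p^expo≢0 {t} {i}}} ≤⟨ /-monoˡ-≤ (p i ^ expo t i) {{p^expo≢0 {t} {i}}} (*-monoʳ-≤ Q (p^expo≤2^ t i)) ⟩
      cell t i                         ∎

    cell<QP : ∀ t i → cell t i < Q * P
    cell<QP t i = m<n*o⇒m/o<n {{p^expo≢0 {t} {i}}} (begin-strict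
      Q * 2 ^ t                  <⟨ *-monoʳ-< Q (2^<p^[1+expo] t i) ⟩
      Q * (p i * p i ^ expo t i) ≤⟨ *-monoʳ-≤ Q (*-monoˡ-≤ (p i ^ expo t i) (p≤P i)) ⟩
      Q * (P * p i ^ expo t i)   ≡⟨ *-assoc Q P _ ⟨
      Q * P * p i ^ expo t i     ∎)

    cells : ℕ → Fin n → Fin (Q * P)
    cells t i = fromℕ< (cell<QP t i)

    -- Packs the n cell numbers into one, so that (QP)^n + 1 exponents compete for (QP)^n codes.
    code : Fin (suc ((Q * P) ^ n)) → Fin ((Q * P) ^ n)
    code t = funToFin (cells (toℕ t))

    code-injective : ∀ s t → code s ≡ code t → ∀ i → cell (toℕ s) i ≡ cell (toℕ t) i
    code-injective s t eq i = begin-equality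
      cell (toℕ s) i                 ≡⟨ toℕ-fromℕ< _ ⟨
      toℕ (cells (toℕ s) i)          ≡⟨ cong toℕ (finToFun-funToFin (cells (toℕ s)) i) ⟨
      toℕ (finToFun (code s) i)      ≡⟨ cong (λ f → toℕ (finToFun f i)) eq ⟩
      toℕ (finToFun (code t) i)      ≡⟨ cong toℕ (finToFun-funToFin (cells (toℕ t)) i) ⟩
      toℕ (cells (toℕ t) i)          ≡⟨ toℕ-fromℕ< _ ⟩
      cell (toℕ t) i                 ∎

  simultaneousApproximation : ∃[ d ] Σ (Fin n → ℕ) λ e →
    1 ≤ d × d ≤ (Q * P) ^ n × (∀ i → Close Q (2 ^ d) (p i ^ e i))
  simultaneousApproximation = fromCollision (pigeonhole (n<1+n ((Q * P) ^ n)) code)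
    where
    fromCollision : (∃[ i ] ∃[ j ] toℕ i < toℕ j × code i ≡ code j) → _
    fromCollision (i , j , s<t , codes≡) =
      -- 2^d / p^e is the quotient of the two ratios sharing a cell. Monotonicity of `expo` makes
      -- the truncated differences exact.
      t ∸ s , (λ k → expo t k ∸ expo s k) , m<n⇒0<n∸m s<t , ≤-trans (m∸n≤m t s) (≤-pred (toℕ<n j)) , close
      where
      s = toℕ i
      t = toℕ j
      s≤t : s ≤ t
      s≤t = <⇒≤ s<t
      close : ∀ k → Close Q (2 ^ (t ∸ s)) (p k ^ (expo t k ∸ expo s k))
      close k = sameCell⇒Close Q (cell t k) (2 ^ s) (p k ^ expo s k) (2 ^ (t ∸ s)) (p k ^ (expo t k ∸ expo s k))
        {{Q≢0}} {{m^n≢0 2 (t ∸ s)}} {{m^n≢0 (p k) (expo t k ∸ expo s k)}} (Q≤cell t k)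
        (subst (λ q → InCell Q q (2 ^ s) (p k ^ expo s k)) (code-injective i j codes≡ k) (/-inCell Q (2 ^ s) (p k ^ expo s k) {{p^expo≢0 {s} {k}}}))
        (subst₂ (InCell Q (cell t k)) (^-split 2 s≤t) (^-split (p k) (expo-mono k s≤t)) (/-inCell Q (2 ^ t) (p k ^ expo t k) {{p^expo≢0 {t} {k}}}))

-- A common point of the intervals

maximum : ∀ {n} (f : Fin (suc n) → ℕ) → ∃[ j ] (∀ i → f i ≤ f j)
maximum {zero} f = zero , λ { zero → ≤-refl }
maximum {suc n} f with j , fi≤fj ← maximum (λ i → f (suc i)) with ≤-total (f zero) (f (suc j))
... | inj₁ f0≤fj = suc j , λ { zero → f0≤fj ; (suc i) → fi≤fj i }
... | inj₂ fj≤f0 = zero , λ { zero → ≤-refl ; (suc i) → ≤-trans (fi≤fj i) fj≤f0 }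

-- For p ≤ P and Q = 2P + 1 one has (1 + 1/Q)² ≤ 1 + 1/p.
Close⇒< : ∀ {P p} x y z → p ≤ P → y * suc (2 * P) < suc (suc (2 * P)) * x →
  x * suc (2 * P) < suc (suc (2 * P)) * (p * z) → y < p * z + z
Close⇒< {P} {p} x y z p≤P yQ<[1+Q]x xQ<[1+Q]pz = *-cancelʳ-< (Q * Q) y (p * z + z) (begin-strict
  y * (Q * Q)                       ≡⟨ *-assoc y Q Q ⟨
  y * Q * Q                         <⟨ *-monoˡ-< Q yQ<[1+Q]x ⟩
  suc Q * x * Q                     ≡⟨ *-assoc (suc Q) x Q ⟩
  suc Q * (x * Q)                   ≤⟨ *-monoʳ-≤ (suc Q) (<⇒≤ xQ<[1+Q]pz) ⟩
  -- Here 4P + 3 = (Q + 1)² - Q², and adding P + 1 completes P(4P + 3) to Q².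
  suc Q * (suc Q * (p * z))         ≡⟨ r₁ P p z ⟩
  p * z * (Q * Q) + (p * (4 * P + 3)) * z ≤⟨ +-monoʳ-≤ (p * z * (Q * Q)) (*-monoˡ-≤ z (*-monoˡ-≤ (4 * P + 3) p≤P)) ⟩
  p * z * (Q * Q) + (P * (4 * P + 3)) * z ≤⟨ +-monoʳ-≤ (p * z * (Q * Q)) (*-monoˡ-≤ z (m≤m+n (P * (4 * P + 3)) (suc P))) ⟩
  p * z * (Q * Q) + (P * (4 * P + 3) + suc P) * z ≡⟨ r₂ P p z ⟩
  (p * z + z) * (Q * Q)             ∎)
  where
  Q = suc (2 * P)
  r₁ : ∀ P p z → suc (suc (2 * P)) * (suc (suc (2 * P)) * (p * z)) ≡ p * z * (suc (2 * P) * suc (2 * P)) + (p * (4 * P + 3)) * z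
  r₁ = solve-∀
  r₂ : ∀ P p z → p * z * (suc (2 * P) * suc (2 * P)) + (P * (4 * P + 3) + suc P) * z ≡ (p * z + z) * (suc (2 * P) * suc (2 * P))
  r₂ = solve-∀

module _ {n : ℕ} (P : ℕ) (p : Fin (suc n) → ℕ) (p-prime : ∀ i → Prime (p i)) (p≤P : ∀ i → p i ≤ P)
  (p-injective : ∀ {i j} → p i ≡ p j → i ≡ j) where

  private
    Q : ℕ
    Q = suc (2 * P)

    1+Q≤2Q : suc Q ≤ 2 * Q
    1+Q≤2Q = begin
      1 + Q ≤⟨ +-monoˡ-≤ Q (s≤s z≤n) ⟩
      Q + Q ≡⟨ cong (Q +_) (+-identityʳ Q) ⟨
      2 * Q ∎

    between : ∀ d i c k → 1 ≤ d → p i ^ c ≤ k → k * Q < suc Q * 2 ^ d → 2 ^ d * Q < suc Q * p i ^ c → k ∈I[ p i , c ]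
    -- Exponent 0 is excluded by d ≥ 1: it would force 2^d Q < Q + 1, although 2^d Q ≥ 2Q.
    between d i zero k 1≤d _ _ 2^dQ<1+Q = contradiction 2^dQ<1+Q (≤⇒≯ (begin
      suc Q * 1   ≡⟨ *-identityʳ (suc Q) ⟩
      suc Q       ≤⟨ 1+Q≤2Q ⟩
      2 * Q       ≤⟨ *-monoˡ-≤ Q (^-monoʳ-≤ 2 1≤d) ⟩
      2 ^ d * Q   ∎))
    between d i (suc c) k _ p^c≤k k≲2^d 2^d≲p^c = s≤s z≤n , p^c≤k ,
      Close⇒< (2 ^ d) k (p i ^ c) (p≤P i) k≲2^d 2^d≲p^c

  -- Taking k as the maximal power settles all left endpoints at once; closeness to 2^d settles the
  -- right ones. Also k < (1 + 1/Q) 2^d ≤ 2^(d+1).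
  distinctPrimes⇒AtLeastI : ∀ d (e : Fin (suc n) → ℕ) → 1 ≤ d → (∀ i → Close Q (2 ^ d) (p i ^ e i)) →
    ∃[ k ] 1 ≤ k × AtLeastI (suc n) k × k ≤ 2 ^ suc d
  distinctPrimes⇒AtLeastI d e 1≤d close = k , m^n>0 (p j) {{prime⇒nonZero (p-prime j)}} (e j) ,
    (tabulate pair , Unique.tabulate⁺ {f = pair} (λ eq → p-injective (cong proj₁ eq)) , All.tabulate⁺ {f = pair} good , ≤-reflexive (sym (length-tabulate pair))) ,
    <⇒≤ (*-cancelʳ-< Q k (2 ^ suc d) (begin-strict
      k * Q         <⟨ proj₂ (close j) ⟩
      suc Q * 2 ^ d ≤⟨ *-monoˡ-≤ (2 ^ d) 1+Q≤2Q ⟩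
      2 * Q * 2 ^ d ≡⟨ swap 2 Q (2 ^ d) ⟩
      2 * 2 ^ d * Q ∎))
    where
    j = proj₁ (maximum (λ i → p i ^ e i))
    k = p j ^ e j
    pair : Fin (suc n) → ℕ × ℕ
    pair i = p i , e i
    swap : ∀ x y z → x * y * z ≡ x * z * y
    swap = solve-∀
    good : ∀ i → GoodPair k (pair i)
    good i = p-prime i , between d i (e i) k 1≤d (proj₂ (maximum (λ i → p i ^ e i)) i) (proj₂ (close j)) (proj₁ (close i))

lookup-injective : ∀ {xs : List ℕ} → Unique xs → ∀ i j → lookup xs i ≡ lookup xs j → i ≡ j
lookup-injective (_ ∷ _) zero zero _ = refl
lookup-injective {x ∷ xs} (x∉xs ∷ _) zero (suc j) eq = contradiction eq (All.lookup x∉xs (∈-lookup j))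
lookup-injective {x ∷ xs} (x∉xs ∷ _) (suc i) zero eq = contradiction (sym eq) (All.lookup x∉xs (∈-lookup i))
lookup-injective (_ ∷ u) (suc i) (suc j) eq = cong suc (lookup-injective u i j eq)

-- Asymptotic estimates

^-distribʳ-* : ∀ m n o → (m * n) ^ o ≡ m ^ o * n ^ o
^-distribʳ-* m n zero = refl
^-distribʳ-* m n (suc o) = trans (cong (m * n *_) (^-distribʳ-* m n o)) (interchange m n (m ^ o) (n ^ o))
  where
  interchange : ∀ a b c d → a * b * (c * d) ≡ a * c * (b * d)
  interchange = solve-∀

n<2^n : ∀ n → n < 2 ^ n
n<2^n zero = ≤-refl
n<2^n (suc n) = begin-strict
  suc n         ≤⟨ n<2^n n ⟩
  2 ^ n         <⟨ m<n+m (2 ^ n) (m^n>0 2 n) ⟩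
  2 ^ n + 2 ^ n ≡⟨ cong (2 ^ n +_) (+-identityʳ (2 ^ n)) ⟨
  2 ^ suc n     ∎

-- With w = ⌊e/2b⌋ one has 8(2 + e) ≤ K(w + 1), and w ≥ K makes this at most 2^w 2^w. The b-th power
-- is then at most 2^(2bw) ≤ 2^e. The threshold 2bK guarantees w ≥ K.
[8[2+e]]^b≤2^e : ∀ b → 1 ≤ b → ∃[ e₀ ] ∀ e → e₀ ≤ e → (8 * (2 + e)) ^ b ≤ 2 ^ e
[8[2+e]]^b≤2^e b@(suc _) _ = K * 2b , bound
  where
  2b = b + b
  K = 8 * (2 + 2b)
  bound : ∀ e → K * 2b ≤ e → (8 * (2 + e)) ^ b ≤ 2 ^ e
  bound e K2b≤e = begin
    (8 * (2 + e)) ^ b     ≤⟨ ^-monoˡ-≤ b base ⟩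
    (2 ^ (w + w)) ^ b     ≡⟨ ^-*-assoc 2 (w + w) b ⟩
    2 ^ ((w + w) * b)     ≡⟨ cong (2 ^_) (r w b) ⟩
    2 ^ (w * 2b)          ≤⟨ ^-monoʳ-≤ 2 (m/n*n≤m e 2b) ⟩
    2 ^ e                 ∎
    where
    w = e / 2b
    r : ∀ w b → (w + w) * b ≡ w * (b + b)
    r = solve-∀
    K≤w : K ≤ w
    K≤w = subst (_≤ w) (m*n/n≡m K 2b) (/-monoˡ-≤ 2b K2b≤e)
    e≤ : e ≤ 2b * suc w
    e≤ = begin
      e                  ≡⟨ m≡m%n+[m/n]*n e 2b ⟩
      e % 2b + w * 2b    ≤⟨ +-monoˡ-≤ (w * 2b) (<⇒≤ (m%n<n e 2b)) ⟩
      2b + w * 2b        ≡⟨ *-comm (suc w) 2b ⟩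
      2b * suc w         ∎
    base : 8 * (2 + e) ≤ 2 ^ (w + w)
    base = begin
      8 * (2 + e)                   ≤⟨ *-monoʳ-≤ 8 (+-mono-≤ (m≤m*n 2 (suc w)) e≤) ⟩
      8 * (2 * suc w + 2b * suc w)  ≡⟨ cong (8 *_) (*-distribʳ-+ (suc w) 2 2b) ⟨
      8 * ((2 + 2b) * suc w)        ≡⟨ *-assoc 8 (2 + 2b) (suc w) ⟨
      K * suc w                     ≤⟨ *-mono-≤ (≤-trans K≤w (<⇒≤ (n<2^n w))) (n<2^n w) ⟩
      2 ^ w * 2 ^ w                 ≡⟨ ^-distribˡ-+-* 2 w w ⟨
      2 ^ (w + w)                   ∎

-- This is 2k with k = nh and h = 2(2 + ⌊lg n⌋). The choice of h gives 2nh ≤ 2^h, whose n-th power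
-- is the hypothesis of `manyPrimes`.
primeBound : ℕ → ℕ
primeBound n = 2 * (n * (2 * (2 + ⌊log⌋ 2 n)))

primeBound>0 : ∀ n → 1 ≤ n → 1 ≤ primeBound n
primeBound>0 n 1≤n = *-mono-≤ {1} {2} (s≤s z≤n) (*-mono-≤ 1≤n (s≤s z≤n))

enoughPrimes : ∀ n → 1 ≤ n → n ≤ length (primesUpTo (primeBound n))
enoughPrimes n 1≤n = manyPrimes n (n * h) (*-mono-≤ 1≤n (s≤s z≤n)) (begin
  (2 * (n * h)) ^ n ≤⟨ ^-monoˡ-≤ n 2nh≤2^h ⟩
  (2 ^ h) ^ n       ≡⟨ ^-*-assoc 2 h n ⟩
  2 ^ (h * n)       ≡⟨ cong (2 ^_) (*-comm h n) ⟩
  2 ^ (n * h)       ∎)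
  where
  l = suc (⌊log⌋ 2 n)
  h = 2 * suc l
  n≤2^l : n ≤ 2 ^ l
  n≤2^l = <⇒≤ (<b^[1+⌊log⌋] 2 n ≤-refl)
  2nh≤2^h : 2 * (n * h) ≤ 2 ^ h
  2nh≤2^h = begin
    2 * (n * (2 * suc l))        ≤⟨ *-monoʳ-≤ 2 (*-mono-≤ n≤2^l (*-monoʳ-≤ 2 (n<2^n l))) ⟩
    2 * (2 ^ l * (2 * 2 ^ l))    ≡⟨ *-assoc 2 (2 ^ l) (2 ^ suc l) ⟨
    2 ^ suc l * 2 ^ suc l        ≡⟨ ^-distribˡ-+-* 2 (suc l) (suc l) ⟨
    2 ^ (suc l + suc l)          ≡⟨ cong (λ u → 2 ^ (suc l + u)) (+-identityʳ (suc l)) ⟨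
    2 ^ h                        ∎

-- With P = `primeBound n`, this is 2P ≤ n^(1 + a/b) for large n. For e = ⌊lg n⌋, 2P = 8(2 + e) n,
-- and the b-th power of the logarithmic factor is at most 2^e ≤ n ≤ n^a.
primeBound-small : ∀ a b → 1 ≤ a → 1 ≤ b → ∃[ N ] ∀ n → 1 ≤ n → N ≤ n → (2 * primeBound n) ^ b ≤ n ^ (a + b)
primeBound-small a b 1≤a 1≤b with e₀ , small ← [8[2+e]]^b≤2^e b 1≤b = 2 ^ e₀ , bound
  where
  bound : ∀ n → 1 ≤ n → 2 ^ e₀ ≤ n → (2 * primeBound n) ^ b ≤ n ^ (a + b)
  bound n 1≤n N≤n = begin
    (2 * primeBound n) ^ b    ≡⟨ cong (_^ b) (r n (2 + e)) ⟩
    (8 * (2 + e) * n) ^ b     ≡⟨ ^-distribʳ-* (8 * (2 + e)) n b ⟩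
    (8 * (2 + e)) ^ b * n ^ b ≤⟨ *-monoˡ-≤ (n ^ b) (small e (≤-pred (^-cancelʳ-< 2 (≤-<-trans N≤n (<b^[1+⌊log⌋] 2 n ≤-refl))))) ⟩
    2 ^ e * n ^ b             ≤⟨ *-monoˡ-≤ (n ^ b) (b^⌊log⌋≤ 2 n 1≤n) ⟩
    n * n ^ b                 ≡⟨ cong (_* n ^ b) (*-identityʳ n) ⟨
    n ^ 1 * n ^ b             ≤⟨ *-monoˡ-≤ (n ^ b) (^-monoʳ-≤ n {{>-nonZero 1≤n}} 1≤a) ⟩
    n ^ a * n ^ b             ≡⟨ ^-distribˡ-+-* n a b ⟨
    n ^ (a + b)               ∎
    where
    e = ⌊log⌋ 2 n
    r : ∀ n f → 2 * (2 * (n * (2 * f))) ≡ 8 * f * n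
    r = solve-∀

-- Since k ≤ 2^(d+1), the quantity to bound is d + 1. It is at most (2P)^(2n), and 2P ≤ n^(1 + a/b).
[1+d]^b≤n^ : ∀ a b n P d → 1 ≤ n → 1 ≤ P → d ≤ (suc (2 * P) * P) ^ n →
  (2 * P) ^ b ≤ n ^ (a + b) → suc d ^ b ≤ n ^ (2 * n * (a + b))
[1+d]^b≤n^ a b n P@(suc P-1) d 1≤n _ d≤ P-small = begin
  suc d ^ b                  ≤⟨ ^-monoˡ-≤ b 1+d≤ ⟩
  ((2 * P) ^ (2 * n)) ^ b    ≡⟨ ^-*-assoc (2 * P) (2 * n) b ⟩
  (2 * P) ^ (2 * n * b)      ≡⟨ cong ((2 * P) ^_) (*-comm (2 * n) b) ⟩
  (2 * P) ^ (b * (2 * n))    ≡⟨ ^-*-assoc (2 * P) b (2 * n) ⟨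
  ((2 * P) ^ b) ^ (2 * n)    ≤⟨ ^-monoˡ-≤ (2 * n) P-small ⟩
  (n ^ (a + b)) ^ (2 * n)    ≡⟨ ^-*-assoc n (a + b) (2 * n) ⟩
  n ^ ((a + b) * (2 * n))    ≡⟨ cong (n ^_) (*-comm (a + b) (2 * n)) ⟩
  n ^ (2 * n * (a + b))      ∎
  where
  instance
    n≢0 : NonZero n
    n≢0 = >-nonZero 1≤n
  r : ∀ x → suc (suc (2 * suc x) * suc x) + (2 * x * x + 3 * x) ≡ (2 * suc x) * ((2 * suc x) * 1)
  r = solve-∀
  1+d≤ : suc d ≤ (2 * P) ^ (2 * n)
  1+d≤ = begin-strict
    d                              ≤⟨ d≤ ⟩
    -- For P ≥ 1, (2P + 1)P < (2P)²; the strictness pays for the 1 in d + 1.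
    (suc (2 * P) * P) ^ n          <⟨ ^-monoˡ-< n (≤-trans (m≤m+n _ (2 * P-1 * P-1 + 3 * P-1)) (≤-reflexive (r P-1))) ⟩
    ((2 * P) ^ 2) ^ n              ≡⟨ ^-*-assoc (2 * P) 2 n ⟩
    (2 * P) ^ (2 * n)              ∎

-- The point k and its size

manyPrimes⇒AtLeastI : ∀ P n → 1 ≤ n → n ≤ length (primesUpTo P) → ∃[ k ] ∃[ d ] 1 ≤ k × AtLeastI n k × k ≤ 2 ^ suc d ×
  d ≤ (suc (2 * P) * P) ^ n
manyPrimes⇒AtLeastI P n@(suc _) _ n≤π = fromApproximation (simultaneousApproximation P n (suc (2 * P)) p
    (λ i → nonTrivial⇒n>1 (p i) {{prime⇒nonTrivial (p-prime i)}}) p≤P)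
  where
  ps = primesUpTo P
  ι : Fin n → Fin (length ps)
  ι i = inject≤ i n≤π
  p : Fin n → ℕ
  p i = lookup ps (ι i)
  p-prime : ∀ i → Prime (p i)
  p-prime i = All.lookup (primesUpTo-prime P) (∈-lookup (ι i))
  p≤P : ∀ i → p i ≤ P
  p≤P i = primesUpTo-≤ (∈-lookup {xs = ps} (ι i))
  p-injective : ∀ {i j} → p i ≡ p j → i ≡ j
  p-injective {i} {j} eq = inject≤-injective n≤π n≤π i j
    (lookup-injective (Unique.filter⁺ prime? (Unique.upTo⁺ (suc P))) (ι i) (ι j) eq)
  fromApproximation : (∃[ d ] Σ (Fin n → ℕ) λ e → 1 ≤ d × d ≤ (suc (2 * P) * P) ^ n ×
      (∀ i → Close (suc (2 * P)) (2 ^ d) (p i ^ e i))) →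
    ∃[ k ] ∃[ d ] 1 ≤ k × AtLeastI n k × k ≤ 2 ^ suc d × d ≤ (suc (2 * P) * P) ^ n
  fromApproximation (d , e , 1≤d , d≤ , close) =
    let k , 1≤k , k∈ , k≤ = distinctPrimes⇒AtLeastI P p p-prime p≤P p-injective d e 1≤d close
    in k , d , 1≤k , k∈ , k≤ , d≤

-- The size estimate is an implication inside the existential, so k is available for every n and is
-- bounded once n is large.
boundedPoint : ∀ a b n P → 1 ≤ n → 1 ≤ P → n ≤ length (primesUpTo P) →
  ∃[ k ] 1 ≤ k × AtLeastI n k ×
    ((2 * P) ^ b ≤ n ^ (a + b) → ∃[ m ] k ≤ 2 ^ m × m ^ b ≤ n ^ (2 * n * (a + b)))
boundedPoint a b n P 1≤n 1≤P n≤π =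
  let k , d , 1≤k , k∈ , k≤2^[1+d] , d≤ = manyPrimes⇒AtLeastI P n 1≤n n≤π
  in k , 1≤k , k∈ , λ P-small → suc d , k≤2^[1+d] , [1+d]^b≤n^ a b n P d 1≤n 1≤P d≤ P-small

-- The ratio a/b stands for ε: m bounds lg k, and m^b ≤ n^(2n(a+b)) means m ≤ 2^(2n lg n (1 + a/b)).
-- Having this eventually for every a/b gives ε(n) → 0; the least admissible k for each n serves all
-- ratios at once. At n = 1 the exponent 2n lg n vanishes whatever ε is, hence the clause k ≤ 2; the
-- other n below N are absorbed into ε(n).
mainTheorem2 : (a b : ℕ) → 1 ≤ a → 1 ≤ b →
    Σ ℕ λ N → (n : ℕ) → 1 ≤ n →
    Σ ℕ λ k → 1 ≤ k × AtLeastI n k × (n ≤ 1 → k ≤ 2) ×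
    (N ≤ n → Σ ℕ λ m → k ≤ 2 ^ m × m ^ b ≤ n ^ (2 * n * (a + b)))
mainTheorem2 a b 1≤a 1≤b = 2 + proj₁ smallness , witness
  where
  smallness : ∃[ N ] ∀ n → 1 ≤ n → N ≤ n → (2 * primeBound n) ^ b ≤ n ^ (a + b)
  smallness = primeBound-small a b 1≤a 1≤b
  N : ℕ
  N = proj₁ smallness
  witness : (n : ℕ) → 1 ≤ n → Σ ℕ λ k → 1 ≤ k × AtLeastI n k × (n ≤ 1 → k ≤ 2) ×
    (2 + N ≤ n → Σ ℕ λ m → k ≤ 2 ^ m × m ^ b ≤ n ^ (2 * n * (a + b)))
  -- I_{2,1} = {2}. The threshold 2 + N makes the asymptotic clause vacuous here.
  witness 1 _ = 2 , s≤s z≤n ,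
    ((2 , 1) ∷ [] , [] ∷ [] , (prime[2] , s≤s z≤n , ≤-refl , ≤-refl) ∷ [] , ≤-refl) ,
    (λ _ → ≤-refl) , λ { (s≤s ()) }
  witness n@(suc (suc _)) 1≤n =
    let k , 1≤k , k∈ , k-bound = boundedPoint a b n (primeBound n) 1≤n (primeBound>0 n 1≤n) (enoughPrimes n 1≤n)
    in k , 1≤k , k∈ , (λ { (s≤s ()) }) , λ 2+N≤n →
      k-bound (proj₂ smallness n 1≤n (≤-trans (m≤n+m N 2) 2+N≤n))
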